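{- Let $k$ be a field and let $A$ be a connected graded $k$-algebra generated in degree $1$. Assume that for every finite-dimensional subspace $W\subset A_1$ there exists a quadratic subalgebra $B_W\subset A$ such that: (a) $W\subset (B_W)_1$ and $\dim_k (B_W)_1<\infty$; (b) $B_W$ is universally Koszul; and assume moreover that the family $(B_W)_W$ can be chosen to be filtered under inclusion. Then $A$ is asymptotically universally Koszul.
   Context: A graded $k$-algebra $A=\bigoplus_{n\ge 0}A_n$ is connected if $A_0=k$. A connected graded $k$-algebra generated in degree $1$ is quadratic if $A\cong T(V)/\langle R\rangle$ as graded algebras, where $V=A_1$ (possibly infinite-dimensional) and $R\subseteq V\otimes_k V$ is a subspace. Subalgebras are graded subalgebras. Universal Koszulity: let $A$ be a quadratic algebra with $\dim_k A_1<\infty$. Let $\mathcal L(A)$ be the set of graded left ideals $I\subseteq A$ with $I=A I_1$ (generated in degree $1$). $A$ is universally Koszul if for every $I\in\mathcal L(A)$ and every $x\in A_1\setminus I_1$, the colon ideal $I:x=\{a\in A\mid ax\in I\}$ belongs to $\mathcal L(A)$. Asymptotic universal Koszulity: a connected graded $k$-algebra $A$ generated in degree $1$ is asymptotically universally Koszul if there exists a filtered system (under inclusion) of quadratic graded subalgebras $(A_i)_{i\in I}$ of $A$ such that (i) each $A_i$ is generated in degree $1$ with $\dim_k(A_i)_1<\infty$; (ii) each $A_i$ is universally Koszul; (iii) the natural map $\varinjlim_{i\in I}A_i\to A$ is an isomorphism of graded algebras; (iv) every finite-dimensional subspace of $A_1$ is contained in some $(A_i)_1$. -}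

module Defs where

open import Algebra.Apartness.Bundles using (HeytingCommutativeRing; HeytingField)
open import Algebra.Bundles using (CommutativeRing; Ring)
open import Algebra.Bundles.Raw using (RawRing)
open import Algebra.Core using (Op₁; Op₂)
import Algebra.Definitions.RawMonoid as RawMonoidSum
open import Algebra.Module.Bundles using (LeftModule)
open import Algebra.Module.Bundles.Raw using (RawLeftModule)
open import Algebra.Module.Core using (Opₗ)
import Algebra.Module.Morphism.LeftModuleMonomorphism as LeftModuleMono
open import Algebra.Module.Morphism.Structures using (IsLeftModuleMonomorphism)
import Algebra.Module.Properties.LeftModule as LeftModuleProperties
open import Algebra.Module.Structures using (IsLeftModule)
import Algebra.Morphism.RingMonomorphism as RingMono
open import Algebra.Morphism.Structures using (IsRingMonomorphism; IsRingIsomorphism)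
open import Algebra.Structures using (IsRing)
open import Data.Fin.Base using (zero; suc; toℕ)
open import Data.List.Base using (List; []; _∷_; _++_; length)
open import Data.Nat.Base as ℕ using (ℕ; zero; suc)
open import Data.Product.Base using (Σ; Σ-syntax; ∃; ∃-syntax; _×_; _,_; proj₁; proj₂)
open import Data.Vec.Functional using (Vector)
open import Function.Base using (_∘_; _on_; id)
open import Level using (Level; _⊔_) renaming (suc to lsuc)
open import Relation.Binary.Core using (Rel)
open import Relation.Binary.Definitions using (_Respects_)
open import Relation.Binary.PropositionalEquality.Core as ≡ using (_≡_)
import Relation.Binary.Reasoning.Setoid as SetoidReasoning
open import Relation.Unary using (Pred; _∈_; _∉_; _⊆_; _∩_; _≐_)

private
  variable
    ℓ a b : Level

-- Classically a HeytingField is a field with x # y meaning ¬ (x ≈ y).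
scalars : HeytingField ℓ ℓ ℓ → Ring ℓ ℓ
scalars k = CommutativeRing.ring
  (HeytingCommutativeRing.commutativeRing (HeytingField.heytingCommutativeRing k))

-- The scalars K in the modules below are always `scalars k` for a field k.
module _ {K : Ring ℓ ℓ} (M : LeftModule K ℓ ℓ) where
  private module K = Ring K
  open LeftModule M
  open RawMonoidSum +ᴹ-rawMonoid using (sum)

  record IsSubspace (W : Pred Carrierᴹ ℓ) : Set ℓ where
    field
      resp      : W Respects _≈ᴹ_
      0∈        : 0ᴹ ∈ W
      +-closed  : ∀ {x y} → x ∈ W → y ∈ W → x +ᴹ y ∈ W
      *ₗ-closed : ∀ c {x} → x ∈ W → c *ₗ x ∈ W

  Span : ∀ {n} → Vector Carrierᴹ n → Pred Carrierᴹ ℓ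
  Span v w = Σ[ c ∈ Vector K.Carrier _ ] w ≈ᴹ sum (λ i → c i *ₗ v i)

  -- Finite dimension is the existence of a finite spanning family;
  -- extracting a basis from one is not constructive in general.
  FiniteDimensional : Pred Carrierᴹ ℓ → Set ℓ
  FiniteDimensional W =
    ∃[ n ] Σ[ v ∈ Vector Carrierᴹ n ] (∀ i → v i ∈ W) × W ⊆ Span v

  -ᴹ≈-1*ₗ : ∀ x → (K.- K.1#) *ₗ x ≈ᴹ -ᴹ x
  -ᴹ≈-1*ₗ x = LeftModuleProperties.inverseʳ-uniqueᴹ M x ((K.- K.1#) *ₗ x) (begin
    x +ᴹ (K.- K.1#) *ₗ x              ≈⟨ +ᴹ-congʳ (*ₗ-identityˡ x) ⟨
    K.1# *ₗ x +ᴹ (K.- K.1#) *ₗ x      ≈⟨ *ₗ-distribʳ x K.1# (K.- K.1#) ⟨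
    (K.1# K.+ (K.- K.1#)) *ₗ x        ≈⟨ *ₗ-congʳ (K.-‿inverseʳ K.1#) ⟩
    K.0# *ₗ x                         ≈⟨ *ₗ-zeroˡ x ⟩
    0ᴹ                                ∎)
    where
    open SetoidReasoning ≈ᴹ-setoid

  -ᴹ-closed : ∀ {W} → IsSubspace W → ∀ {x} → x ∈ W → -ᴹ x ∈ W
  -ᴹ-closed W-sub {x} x∈W =
    IsSubspace.resp W-sub (-ᴹ≈-1*ₗ x) (IsSubspace.*ₗ-closed W-sub _ x∈W)

  module _ {W : Pred Carrierᴹ ℓ} (W-sub : IsSubspace W) where
    open IsSubspace W-sub

    subspaceRaw : RawLeftModule K.Carrier ℓ ℓ
    subspaceRaw = record
      { Carrierᴹ = Σ Carrierᴹ W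
      ; _≈ᴹ_     = _≈ᴹ_ on proj₁
      ; _+ᴹ_     = λ (x , x∈) (y , y∈) → x +ᴹ y , +-closed x∈ y∈
      ; _*ₗ_     = λ c (x , x∈) → c *ₗ x , *ₗ-closed c x∈
      ; 0ᴹ       = 0ᴹ , 0∈
      ; -ᴹ_      = λ (x , x∈) → -ᴹ x , -ᴹ-closed W-sub x∈
      }

    subspaceInclusion : IsLeftModuleMonomorphism subspaceRaw rawLeftModule proj₁
    subspaceInclusion = record
      { isLeftModuleHomomorphism = record
        { +ᴹ-isGroupHomomorphism = record
          { isMonoidHomomorphism = record
            { isMagmaHomomorphism = record
              { isRelHomomorphism = record { cong = id }
              ; homo = λ _ _ → ≈ᴹ-refl
              }
            ; ε-homo = ≈ᴹ-refl
            }
          ; ⁻¹-homo = λ _ → ≈ᴹ-refl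
          }
        ; *ₗ-homo = λ _ _ → ≈ᴹ-refl
        }
      ; injective = id
      }

    subspaceModule : LeftModule K ℓ ℓ
    subspaceModule = record
      { isLeftModule = LeftModuleMono.isLeftModule subspaceInclusion
          K.isRing isLeftModule }

-- Operations and grading without laws, which is all that the notion of
-- isomorphism refers to.  Quotients of tensor algebras and direct limits are
-- given in this form.
record RawGradedAlgebra (K : Set ℓ) a : Set (ℓ ⊔ lsuc a) where
  infix  8 -_
  infixr 7 _*ₗ_
  infixl 7 _*_
  infixl 6 _+_
  infix  4 _≈_
  field
    Carrier : Set a
    _≈_     : Rel Carrier a
    _+_     : Op₂ Carrier
    _*_     : Op₂ Carrier
    -_      : Op₁ Carrier
    0#      : Carrier
    1#      : Carrier
    _*ₗ_    : Opₗ K Carrier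
    Deg     : ℕ → Pred Carrier a

  rawRing : RawRing a a
  rawRing = record
    { _≈_ = _≈_ ; _+_ = _+_ ; _*_ = _*_ ; -_ = -_ ; 0# = 0# ; 1# = 1# }

  open RawMonoidSum (RawRing.+-rawMonoid rawRing) public using (sum)

  -- P = ⨁ₙ (P ∩ Deg n), given that the sum of the Deg n is direct.
  IsGraded : Pred Carrier a → Set a
  IsGraded P = ∀ {x} → x ∈ P →
    ∃[ N ] Σ[ f ∈ Vector Carrier N ] (∀ i → f i ∈ P ∩ Deg (toℕ i)) × x ≈ sum f

record IsGradedAlgebraIsomorphism {K : Set ℓ}
         (A : RawGradedAlgebra K a) (B : RawGradedAlgebra K b)
         (f : RawGradedAlgebra.Carrier A → RawGradedAlgebra.Carrier B)
         : Set (ℓ ⊔ a ⊔ b) where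
  private
    module A = RawGradedAlgebra A
    module B = RawGradedAlgebra B
  field
    isRingIsomorphism : IsRingIsomorphism A.rawRing B.rawRing f
    *ₗ-homo           : ∀ c x → f (c A.*ₗ x) B.≈ c B.*ₗ f x
    Deg-preserving    : ∀ {n x} → x ∈ A.Deg n → f x ∈ B.Deg n
    Deg-reflecting    : ∀ {n x} → f x ∈ B.Deg n → x ∈ A.Deg n

infix 4 _≅_

_≅_ : {K : Set ℓ} → RawGradedAlgebra K a → RawGradedAlgebra K b → Set _
A ≅ B = ∃[ f ] IsGradedAlgebraIsomorphism A B f

record GradedAlgebra (k : HeytingField ℓ ℓ ℓ) : Set (lsuc ℓ) where
  field
    rawGradedAlgebra : RawGradedAlgebra (HeytingField.Carrier k) ℓ

  open RawGradedAlgebra rawGradedAlgebra public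

  field
    isRing       : IsRing _≈_ _+_ _*_ -_ 0# 1#
    isLeftModule : IsLeftModule (scalars k) _≈_ _+_ 0# -_ _*ₗ_
    *ₗ-*-assoc   : ∀ c x y → (c *ₗ x) * y ≈ c *ₗ (x * y)
    *-*ₗ-comm    : ∀ c x y → x * (c *ₗ y) ≈ c *ₗ (x * y)

  ring : Ring ℓ ℓ
  ring = record { isRing = isRing }

  leftModule : LeftModule (scalars k) ℓ ℓ
  leftModule = record { isLeftModule = isLeftModule }

  field
    Deg-isSubspace : ∀ n → IsSubspace leftModule (Deg n)
    1∈Deg₀         : 1# ∈ Deg 0
    *-Deg          : ∀ {m n x y} → x ∈ Deg m → y ∈ Deg n → x * y ∈ Deg (m ℕ.+ n)
    decomposition  : ∀ x → ∃[ N ] Σ[ f ∈ Vector Carrier N ]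
                       (∀ i → f i ∈ Deg (toℕ i)) × x ≈ sum f
    independence   : ∀ {N} (f : Vector Carrier N) → (∀ i → f i ∈ Deg (toℕ i)) →
                       sum f ≈ 0# → ∀ i → f i ≈ 0#

module _ {k : HeytingField ℓ ℓ ℓ} (A : GradedAlgebra k) where
  open GradedAlgebra A
  private module K = HeytingField k

  -- The unit map k → A₀ is bijective.
  record Connected : Set ℓ where
    field
      unit-injective  : ∀ c → c *ₗ 1# ≈ 0# → c K.≈ K.0#
      unit-surjective : ∀ {x} → x ∈ Deg 0 → ∃[ c ] x ≈ c *ₗ 1#

  data AlgebraGeneratedBy (S : Pred Carrier ℓ) : Pred Carrier ℓ where
    gen      : S ⊆ AlgebraGeneratedBy S
    0-gen    : 0# ∈ AlgebraGeneratedBy S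
    1-gen    : 1# ∈ AlgebraGeneratedBy S
    +-gen    : ∀ {x y} → x ∈ AlgebraGeneratedBy S → y ∈ AlgebraGeneratedBy S →
               x + y ∈ AlgebraGeneratedBy S
    *-gen    : ∀ {x y} → x ∈ AlgebraGeneratedBy S → y ∈ AlgebraGeneratedBy S →
               x * y ∈ AlgebraGeneratedBy S
    *ₗ-gen   : ∀ c {x} → x ∈ AlgebraGeneratedBy S → c *ₗ x ∈ AlgebraGeneratedBy S
    resp-gen : AlgebraGeneratedBy S Respects _≈_

  GeneratedInDegreeOne : Set ℓ
  GeneratedInDegreeOne = ∀ x → x ∈ AlgebraGeneratedBy (Deg 1)

-- T(V) = ⨁ₙ V^{⊗n}, with V^{⊗n} the free K-module on n-tuples of vectors
-- modulo multilinearity.  `word (v₁ ∷ … ∷ vₙ ∷ [])` is v₁ ⊗ ⋯ ⊗ vₙ, and a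
-- term is a formal linear combination of words of any lengths.
module TensorAlgebra {K : Ring ℓ ℓ} (V : LeftModule K ℓ ℓ) where
  private
    module K = Ring K
    module V = LeftModule V

  infix  8 ⊟_
  infixr 7 _⊡_
  infixl 7 _⊠_
  infixl 6 _⊞_
  infix  4 _∼_

  data Tensor : Set ℓ where
    word : List V.Carrierᴹ → Tensor
    𝟎    : Tensor
    _⊞_  : Tensor → Tensor → Tensor
    ⊟_   : Tensor → Tensor
    _⊡_  : K.Carrier → Tensor → Tensor

  data _∼_ : Rel Tensor ℓ where
    ∼-refl  : ∀ {t} → t ∼ t
    ∼-sym   : ∀ {t u} → t ∼ u → u ∼ t
    ∼-trans : ∀ {t u w} → t ∼ u → u ∼ w → t ∼ w

    ⊞-cong : ∀ {t t′ u u′} → t ∼ t′ → u ∼ u′ → t ⊞ u ∼ t′ ⊞ u′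
    ⊟-cong : ∀ {t t′} → t ∼ t′ → ⊟ t ∼ ⊟ t′
    ⊡-cong : ∀ {c c′ t t′} → c K.≈ c′ → t ∼ t′ → c ⊡ t ∼ c′ ⊡ t′

    ⊞-assoc     : ∀ t u w → (t ⊞ u) ⊞ w ∼ t ⊞ (u ⊞ w)
    ⊞-comm      : ∀ t u → t ⊞ u ∼ u ⊞ t
    ⊞-identityˡ : ∀ t → 𝟎 ⊞ t ∼ t
    ⊟-inverseˡ  : ∀ t → ⊟ t ⊞ t ∼ 𝟎
    ⊡-distribˡ  : ∀ c t u → c ⊡ (t ⊞ u) ∼ c ⊡ t ⊞ c ⊡ u
    ⊡-distribʳ  : ∀ t c d → (c K.+ d) ⊡ t ∼ c ⊡ t ⊞ d ⊡ t
    ⊡-assoc     : ∀ c d t → (c K.* d) ⊡ t ∼ c ⊡ (d ⊡ t)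
    ⊡-identityˡ : ∀ t → K.1# ⊡ t ∼ t

    word-cong : ∀ us {v v′} ws → v V.≈ᴹ v′ → word (us ++ v ∷ ws) ∼ word (us ++ v′ ∷ ws)
    word-+    : ∀ us v v′ ws →
                word (us ++ (v V.+ᴹ v′) ∷ ws) ∼ word (us ++ v ∷ ws) ⊞ word (us ++ v′ ∷ ws)
    word-*ₗ   : ∀ us c v ws → word (us ++ (c V.*ₗ v) ∷ ws) ∼ c ⊡ word (us ++ v ∷ ws)

  prepend : List V.Carrierᴹ → Tensor → Tensor
  prepend v (word w) = word (v ++ w)
  prepend v 𝟎        = 𝟎
  prepend v (t ⊞ u)  = prepend v t ⊞ prepend v u
  prepend v (⊟ t)    = ⊟ prepend v t
  prepend v (c ⊡ t)  = c ⊡ prepend v t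

  _⊠_ : Op₂ Tensor
  word v  ⊠ t = prepend v t
  𝟎       ⊠ t = 𝟎
  (s ⊞ u) ⊠ t = s ⊠ t ⊞ u ⊠ t
  (⊟ s)   ⊠ t = ⊟ (s ⊠ t)
  (c ⊡ s) ⊠ t = c ⊡ (s ⊠ t)

  data WordsOfLength (n : ℕ) : Pred Tensor ℓ where
    word : ∀ {w} → length w ≡ n → word w ∈ WordsOfLength n
    𝟎    : 𝟎 ∈ WordsOfLength n
    _⊞_  : ∀ {t u} → t ∈ WordsOfLength n → u ∈ WordsOfLength n → t ⊞ u ∈ WordsOfLength n
    ⊟_   : ∀ {t} → t ∈ WordsOfLength n → ⊟ t ∈ WordsOfLength n
    _⊡_  : ∀ c {t} → t ∈ WordsOfLength n → c ⊡ t ∈ WordsOfLength n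

  -- V^{⊗n} inside T(V)
  Power : ℕ → Pred Tensor ℓ
  Power n t = ∃[ u ] u ∈ WordsOfLength n × t ∼ u

  tensorModule : LeftModule K ℓ ℓ
  tensorModule = record
    { Carrierᴹ = Tensor ; _≈ᴹ_ = _∼_ ; _+ᴹ_ = _⊞_ ; _*ₗ_ = _⊡_ ; 0ᴹ = 𝟎 ; -ᴹ_ = ⊟_
    ; isLeftModule = record
      { isLeftSemimodule = record
        { +ᴹ-isCommutativeMonoid = record
          { isMonoid = record
            { isSemigroup = record
              { isMagma = record
                { isEquivalence = record { refl = ∼-refl ; sym = ∼-sym ; trans = ∼-trans }
                ; ∙-cong = ⊞-cong
                }
              ; assoc = ⊞-assoc
              }
            ; identity = ⊞-identityˡ , ⊞-identityʳ
            }
          ; comm = ⊞-comm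
          }
        ; isPreleftSemimodule = record
          { *ₗ-cong = ⊡-cong
          ; *ₗ-zeroˡ = ⊡-zeroˡ
          ; *ₗ-distribʳ = ⊡-distribʳ
          ; *ₗ-identityˡ = ⊡-identityˡ
          ; *ₗ-assoc = ⊡-assoc
          ; *ₗ-zeroʳ = ⊡-zeroʳ
          ; *ₗ-distribˡ = ⊡-distribˡ
          }
        }
      ; -ᴹ‿cong = ⊟-cong
      ; -ᴹ‿inverse = ⊟-inverseˡ , λ t → ∼-trans (⊞-comm _ _) (⊟-inverseˡ t)
      }
    }
    where
    ⊞-identityʳ : ∀ t → t ⊞ 𝟎 ∼ t
    ⊞-identityʳ t = ∼-trans (⊞-comm _ _) (⊞-identityˡ t)

    idempotent⇒𝟎 : ∀ {t} → t ∼ t ⊞ t → t ∼ 𝟎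
    idempotent⇒𝟎 {t} t∼t⊞t =
      ∼-trans (∼-sym (⊞-identityˡ t))
      (∼-trans (⊞-cong (∼-sym (⊟-inverseˡ t)) ∼-refl)
      (∼-trans (⊞-assoc _ _ _)
      (∼-trans (⊞-cong ∼-refl (∼-sym t∼t⊞t)) (⊟-inverseˡ t))))

    ⊡-zeroˡ : ∀ t → K.0# ⊡ t ∼ 𝟎
    ⊡-zeroˡ t = idempotent⇒𝟎
      (∼-trans (⊡-cong (K.sym (K.+-identityˡ K.0#)) ∼-refl) (⊡-distribʳ t K.0# K.0#))

    ⊡-zeroʳ : ∀ c → c ⊡ 𝟎 ∼ 𝟎
    ⊡-zeroʳ c = idempotent⇒𝟎
      (∼-trans (⊡-cong K.refl (∼-sym (⊞-identityˡ 𝟎))) (⊡-distribˡ c 𝟎 𝟎))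

  open RawMonoidSum (LeftModule.+ᴹ-rawMonoid tensorModule) using (sum)

  -- The two-sided ideal of finite sums ∑ pᵢ rᵢ qᵢ with rᵢ ∈ R.
  ⟨_⟩ : Pred Tensor ℓ → Pred Tensor ℓ
  ⟨ R ⟩ t = ∃[ n ] Σ[ p ∈ Vector Tensor n ] Σ[ r ∈ Vector Tensor n ] Σ[ q ∈ Vector Tensor n ]
    (∀ i → r i ∈ R) × t ∼ sum (λ i → p i ⊠ r i ⊠ q i)

  infixl 5 T/_

  -- T(V)/⟨R⟩ as a setoid: the terms of T(V), equal when they differ by an
  -- element of ⟨R⟩.
  T/_ : Pred Tensor ℓ → RawGradedAlgebra K.Carrier ℓ
  T/ R = record
    { Carrier = Tensor
    ; _≈_     = _≈_
    ; _+_     = _⊞_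
    ; _*_     = _⊠_
    ; -_      = ⊟_
    ; 0#      = 𝟎
    ; 1#      = word []
    ; _*ₗ_    = _⊡_
    ; Deg     = λ n t → ∃[ u ] u ∈ Power n × t ≈ u
    }
    where
    _≈_ : Rel Tensor ℓ
    t ≈ u = t ⊞ ⊟ u ∈ ⟨ R ⟩

module _ {k : HeytingField ℓ ℓ ℓ} (A : GradedAlgebra k) where
  open GradedAlgebra A

  degreeOneModule : LeftModule (scalars k) ℓ ℓ
  degreeOneModule = subspaceModule leftModule (Deg-isSubspace 1)

  open TensorAlgebra degreeOneModule

  record Quadratic : Set (lsuc ℓ) where
    field
      connected            : Connected A
      generatedInDegreeOne : GeneratedInDegreeOne A
      R                    : Pred Tensor ℓ
      R-isSubspace         : IsSubspace tensorModule R
      R⊆V⊗V                : R ⊆ Power 2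
      presentation         : rawGradedAlgebra ≅ T/ R

module _ {k : HeytingField ℓ ℓ ℓ} (A : GradedAlgebra k) where
  open GradedAlgebra A

  record IsLeftIdeal (I : Pred Carrier ℓ) : Set ℓ where
    field
      resp     : I Respects _≈_
      0∈       : 0# ∈ I
      +-closed : ∀ {x y} → x ∈ I → y ∈ I → x + y ∈ I
      *-closed : ∀ x {y} → y ∈ I → x * y ∈ I

  -- A S, the set of finite sums ∑ aᵢ sᵢ with sᵢ ∈ S.
  LeftIdealGeneratedBy : Pred Carrier ℓ → Pred Carrier ℓ
  LeftIdealGeneratedBy S x =
    ∃[ n ] Σ[ p ∈ Vector Carrier n ] Σ[ s ∈ Vector Carrier n ]
      (∀ i → s i ∈ S) × x ≈ sum (λ i → p i * s i)

  record Is𝓛 (I : Pred Carrier ℓ) : Set ℓ where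
    field
      isLeftIdeal          : IsLeftIdeal I
      isGraded             : IsGraded I
      generatedInDegreeOne : I ≐ LeftIdealGeneratedBy (I ∩ Deg 1)

  infix 6 _∶_

  _∶_ : Pred Carrier ℓ → Carrier → Pred Carrier ℓ
  (I ∶ x) y = y * x ∈ I

  record UniversallyKoszul : Set (lsuc ℓ) where
    field
      quadratic    : Quadratic A
      dim₁<∞       : FiniteDimensional leftModule (Deg 1)
      colon-closed : ∀ I → Is𝓛 I → ∀ x → x ∈ Deg 1 → x ∉ I ∩ Deg 1 → Is𝓛 (I ∶ x)

module _ {k : HeytingField ℓ ℓ ℓ} (A : GradedAlgebra k) where
  open GradedAlgebra A

  record Subalgebra : Set (lsuc ℓ) where
    field
      Member     : Pred Carrier ℓ
      isSubspace : IsSubspace leftModule Member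
      1-closed   : 1# ∈ Member
      *-closed   : ∀ {x y} → x ∈ Member → y ∈ Member → x * y ∈ Member
      isGraded   : IsGraded Member

  record FiniteDimensionalSubspace₁ : Set (lsuc ℓ) where
    field
      Member            : Pred Carrier ℓ
      isSubspace        : IsSubspace leftModule Member
      ⊆Deg₁             : Member ⊆ Deg 1
      finiteDimensional : FiniteDimensional leftModule Member

module _ {k : HeytingField ℓ ℓ ℓ} {A : GradedAlgebra k} (B : Subalgebra A) where
  private module A = GradedAlgebra A
  open Subalgebra B
  open IsSubspace isSubspace

  subalgebraRaw : RawGradedAlgebra (HeytingField.Carrier k) ℓ
  subalgebraRaw = record
    { Carrier = Σ A.Carrier Member
    ; _≈_     = A._≈_ on proj₁
    ; _+_     = λ (x , x∈) (y , y∈) → x A.+ y , +-closed x∈ y∈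
    ; _*_     = λ (x , x∈) (y , y∈) → x A.* y , *-closed x∈ y∈
    ; -_      = λ (x , x∈) → A.- x , -ᴹ-closed A.leftModule isSubspace x∈
    ; 0#      = A.0# , 0∈
    ; 1#      = A.1# , 1-closed
    ; _*ₗ_    = λ c (x , x∈) → c A.*ₗ x , *ₗ-closed c x∈
    ; Deg     = λ n x → proj₁ x ∈ A.Deg n
    }

  private
    module R = Ring A.ring
    module B = RawGradedAlgebra subalgebraRaw

    inclusion : IsRingMonomorphism B.rawRing A.rawRing proj₁
    inclusion = record
      { isRingHomomorphism = record
        { isSemiringHomomorphism = record
          { isNearSemiringHomomorphism = record
            { +-isMonoidHomomorphism = record
              { isMagmaHomomorphism = record
                { isRelHomomorphism = record { cong = id }
                ; homo = λ _ _ → R.refl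
                }
              ; ε-homo = R.refl
              }
            ; *-homo = λ _ _ → R.refl
            }
          ; 1#-homo = R.refl
          }
        ; -‿homo = λ _ → R.refl
        }
      ; injective = id
      }

    sum-proj₁ : ∀ {n} (f : Vector B.Carrier n) → proj₁ (B.sum f) ≡ A.sum (proj₁ ∘ f)
    sum-proj₁ {zero}  f = ≡.refl
    sum-proj₁ {suc n} f = ≡.cong (proj₁ (f zero) A.+_) (sum-proj₁ (f ∘ suc))

  toGradedAlgebra : GradedAlgebra k
  toGradedAlgebra = record
    { rawGradedAlgebra = subalgebraRaw
    ; isRing           = RingMono.isRing inclusion A.isRing
    ; isLeftModule     = LeftModule.isLeftModule (subspaceModule A.leftModule isSubspace)
    ; *ₗ-*-assoc       = λ c x y → A.*ₗ-*-assoc c (proj₁ x) (proj₁ y)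
    ; *-*ₗ-comm        = λ c x y → A.*-*ₗ-comm c (proj₁ x) (proj₁ y)
    ; Deg-isSubspace   = λ n → let module D = IsSubspace (A.Deg-isSubspace n) in record
      { resp      = D.resp
      ; 0∈        = D.0∈
      ; +-closed  = D.+-closed
      ; *ₗ-closed = λ c → D.*ₗ-closed c
      }
    ; 1∈Deg₀           = A.1∈Deg₀
    ; *-Deg            = A.*-Deg
    ; decomposition    = λ (x , x∈) → let N , f , f∈ , x≈ = isGraded x∈
                                          g = λ i → f i , proj₁ (f∈ i)
                                      in N , g , proj₂ ∘ f∈ ,
                                         R.trans x≈ (R.reflexive (≡.sym (sum-proj₁ g)))
    ; independence     = λ f f∈ f≈0 → A.independence (proj₁ ∘ f) f∈
                           (R.trans (R.reflexive (≡.sym (sum-proj₁ f))) f≈0)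
    }

module _ {k : HeytingField ℓ ℓ ℓ} {A : GradedAlgebra k} where
  private module A = GradedAlgebra A

  infix 4 _≤_

  _≤_ : Rel (Subalgebra A) ℓ
  B ≤ C = Subalgebra.Member B ⊆ Subalgebra.Member C

  transition : ∀ B C → B ≤ C → Σ A.Carrier (Subalgebra.Member B) →
                                  Σ A.Carrier (Subalgebra.Member C)
  transition B C B≤C (x , x∈B) = x , B≤C x∈B

  record Filtered {I : Set a} (B : I → Subalgebra A) : Set (ℓ ⊔ a) where
    field
      inhabited : I
      bound     : I → I → I
      boundˡ    : ∀ i j → B i ≤ B (bound i j)
      boundʳ    : ∀ i j → B j ≤ B (bound i j)

  -- Elements are represented at some stage of the system, are equal when
  -- their images agree at a common later stage, and are combined there.
  module _ {I : Set (lsuc ℓ)} (B : I → Subalgebra A) (F : Filtered B) where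
    open Filtered F
    private
      module B i = GradedAlgebra (toGradedAlgebra (B i))

      toˡ : ∀ i j → B.Carrier i → B.Carrier (bound i j)
      toˡ i j = transition (B i) (B (bound i j)) (boundˡ i j)

      toʳ : ∀ i j → B.Carrier j → B.Carrier (bound i j)
      toʳ i j = transition (B j) (B (bound i j)) (boundʳ i j)

    directLimit : RawGradedAlgebra (HeytingField.Carrier k) (lsuc ℓ)
    directLimit = record
      { Carrier = Lim
      ; _≈_     = _≈_
      ; _+_     = λ (i , x) (j , y) → bound i j , B._+_ (bound i j) (toˡ i j x) (toʳ i j y)
      ; _*_     = λ (i , x) (j , y) → bound i j , B._*_ (bound i j) (toˡ i j x) (toʳ i j y)
      ; -_      = λ (i , x) → i , B.-_ i x
      ; 0#      = inhabited , B.0# inhabited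
      ; 1#      = inhabited , B.1# inhabited
      ; _*ₗ_    = λ c (i , x) → i , B._*ₗ_ i c x
      ; Deg     = λ n x → ∃[ j ] Σ[ y ∈ B.Carrier j ] y ∈ B.Deg j n × x ≈ (j , y)
      }
      where
      Lim : Set (lsuc ℓ)
      Lim = Σ I B.Carrier

      _≈_ : Rel Lim (lsuc ℓ)
      (i , x) ≈ (j , y) = ∃[ l ] Σ[ i≤l ∈ B i ≤ B l ] Σ[ j≤l ∈ B j ≤ B l ]
        B._≈_ l (transition (B i) (B l) i≤l x) (transition (B j) (B l) j≤l y)

    naturalMap : RawGradedAlgebra.Carrier directLimit → A.Carrier
    naturalMap (i , x) = proj₁ x

module _ {k : HeytingField ℓ ℓ ℓ} (A : GradedAlgebra k) where
  private module A = GradedAlgebra A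

  -- The indices live one universe above A, as the subspaces of A₁ and the
  -- subalgebras of A do.
  record AsymptoticallyUniversallyKoszul : Set (lsuc (lsuc ℓ)) where
    field
      connected            : Connected A
      generatedInDegreeOne : GeneratedInDegreeOne A

      Index    : Set (lsuc ℓ)
      system   : Index → Subalgebra A
      filtered : Filtered system

    private module S i = GradedAlgebra (toGradedAlgebra (system i))

    field
      system-quadratic   : ∀ i → Quadratic (toGradedAlgebra (system i))
      system-generated   : ∀ i → GeneratedInDegreeOne (toGradedAlgebra (system i))
      system-dim₁<∞      : ∀ i → FiniteDimensional (S.leftModule i) (S.Deg i 1)
      system-UK          : ∀ i → UniversallyKoszul (toGradedAlgebra (system i))
      limit-isomorphism  : IsGradedAlgebraIsomorphism (directLimit system filtered)
                             A.rawGradedAlgebra (naturalMap system filtered)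
      exhaustion         : ∀ (W : FiniteDimensionalSubspace₁ A) → ∃[ i ]
                             FiniteDimensionalSubspace₁.Member W
                               ⊆ Subalgebra.Member (system i) ∩ A.Deg 1

{-# OPTIONS --safe #-}
module Submission where

-- The given family is itself the required system.  Each x ∈ A₁ lies in B_W for
-- the line W = k x, and a directed union of subalgebras is a subalgebra, so the
-- B_W exhaust A; the natural map from the limit is then the identity on elements.

open import Defs
open import Level using (Level) renaming (suc to lsuc)
open import Algebra.Apartness.Bundles using (HeytingField)
open import Algebra.Bundles using (Ring)
open import Algebra.Module.Bundles using (LeftModule)
open import Data.Product.Base using (∃-syntax; _,_; proj₁; proj₂)
open import Relation.Unary using (Pred; _∈_; _⊆_; _∩_)

module _ {ℓ : Level} {K : Ring ℓ ℓ} (M : LeftModule K ℓ ℓ) where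
  private module K = Ring K
  open LeftModule M

  Line : Carrierᴹ → Pred Carrierᴹ ℓ
  Line x y = ∃[ c ] y ≈ᴹ c *ₗ x

  ∈Line : ∀ x → x ∈ Line x
  ∈Line x = K.1# , ≈ᴹ-sym (*ₗ-identityˡ x)

  Line-isSubspace : ∀ x → IsSubspace M (Line x)
  Line-isSubspace x = record
    { resp      = λ y≈z (c , y≈cx) → c , ≈ᴹ-trans (≈ᴹ-sym y≈z) y≈cx
    ; 0∈        = K.0# , ≈ᴹ-sym (*ₗ-zeroˡ x)
    ; +-closed  = λ (c , y≈cx) (d , z≈dx) →
        c K.+ d , ≈ᴹ-trans (+ᴹ-cong y≈cx z≈dx) (≈ᴹ-sym (*ₗ-distribʳ x c d))
    ; *ₗ-closed = λ c (d , y≈dx) →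
        c K.* d , ≈ᴹ-trans (*ₗ-congˡ y≈dx) (≈ᴹ-sym (*ₗ-assoc c d x))
    }

  Line-finiteDimensional : ∀ x → FiniteDimensional M (Line x)
  Line-finiteDimensional x =
    1 , (λ _ → x) , (λ _ → ∈Line x) ,
    -- The sum over the one-element family unfolds to `c *ₗ x +ᴹ 0ᴹ`, hence the right identity.
    λ (c , y≈cx) → (λ _ → c) , ≈ᴹ-trans y≈cx (≈ᴹ-sym (+ᴹ-identityʳ (c *ₗ x)))

  Line⊆ : ∀ {W x} → IsSubspace M W → x ∈ W → Line x ⊆ W
  Line⊆ W-sub x∈W (c , y≈cx) =
    IsSubspace.resp W-sub (≈ᴹ-sym y≈cx) (IsSubspace.*ₗ-closed W-sub c x∈W)

module _ {ℓ : Level} {k : HeytingField ℓ ℓ ℓ} {A : GradedAlgebra k} where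
  private
    module A = GradedAlgebra A
    module R = Ring A.ring

  line₁ : ∀ {x} → x ∈ A.Deg 1 → FiniteDimensionalSubspace₁ A
  line₁ {x} x∈A₁ = record
    { Member            = Line A.leftModule x
    ; isSubspace        = Line-isSubspace A.leftModule x
    ; ⊆Deg₁             = Line⊆ A.leftModule (A.Deg-isSubspace 1) x∈A₁
    ; finiteDimensional = Line-finiteDimensional A.leftModule x
    }

  module _ {I : Set (lsuc ℓ)} (B : I → Subalgebra A) (F : Filtered B) where
    open Filtered F
    private module B i = Subalgebra (B i)

    -- Induction on how `x` is generated: constants sit at the stage `inhabited`, scalar multiples
    -- stay at their stage, and sums and products are formed at `bound i j`, where both arguments
    -- are available. The union is not packaged as a `Subalgebra` because the existential over `I`
    -- lives one universe too high for a `Member` predicate.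
    generated-by-union : ∀ {S} → (∀ {x} → x ∈ S → ∃[ i ] x ∈ B.Member i) →
      ∀ {x} → x ∈ AlgebraGeneratedBy A S → ∃[ i ] x ∈ B.Member i
    generated-by-union S⊆ (gen x∈S) = S⊆ x∈S
    generated-by-union S⊆ 0-gen = inhabited , IsSubspace.0∈ (B.isSubspace inhabited)
    generated-by-union S⊆ 1-gen = inhabited , B.1-closed inhabited
    generated-by-union S⊆ (+-gen x∈ y∈) =
      let i , x∈Bᵢ = generated-by-union S⊆ x∈
          j , y∈Bⱼ = generated-by-union S⊆ y∈
          l        = bound i j
      in l , IsSubspace.+-closed (B.isSubspace l) (boundˡ i j x∈Bᵢ) (boundʳ i j y∈Bⱼ)
    generated-by-union S⊆ (*-gen x∈ y∈) =
      let i , x∈Bᵢ = generated-by-union S⊆ x∈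
          j , y∈Bⱼ = generated-by-union S⊆ y∈
      in bound i j , B.*-closed (bound i j) (boundˡ i j x∈Bᵢ) (boundʳ i j y∈Bⱼ)
    generated-by-union S⊆ (*ₗ-gen c x∈) =
      let i , x∈Bᵢ = generated-by-union S⊆ x∈
      in i , IsSubspace.*ₗ-closed (B.isSubspace i) c x∈Bᵢ
    generated-by-union S⊆ (resp-gen x≈y x∈) =
      let i , x∈Bᵢ = generated-by-union S⊆ x∈
      in i , IsSubspace.resp (B.isSubspace i) x≈y x∈Bᵢ

    -- Operations in the limit, and equality at every stage, are those of `A` on underlying
    -- elements, so the homomorphism laws hold by reflexivity; `covers` supplies surjectivity.
    naturalMap-isIsomorphism : (∀ x → ∃[ i ] x ∈ B.Member i) →
      IsGradedAlgebraIsomorphism (directLimit B F) A.rawGradedAlgebra (naturalMap B F)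
    naturalMap-isIsomorphism covers = record
      { isRingIsomorphism = record
        { isRingMonomorphism = record
          { isRingHomomorphism = record
            { isSemiringHomomorphism = record
              { isNearSemiringHomomorphism = record
                { +-isMonoidHomomorphism = record
                  { isMagmaHomomorphism = record
                    { isRelHomomorphism = record { cong = λ (_ , _ , _ , x≈y) → x≈y }
                    ; homo = λ _ _ → R.refl
                    }
                  ; ε-homo = R.refl
                  }
                ; *-homo = λ _ _ → R.refl
                }
              ; 1#-homo = R.refl
              }
            ; -‿homo = λ _ → R.refl
            }
          -- Equality in the limit asks for a common later stage; since the transition maps are
          -- inclusions, any upper bound of `i` and `j` serves.
          ; injective = λ { {i , _} {j , _} x≈y → bound i j , boundˡ i j , boundʳ i j , x≈y }
          }
        -- Surjectivity is stated up to equality: every `z` equal in the limit to the chosen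
        -- preimage must also map to `x`, and the witness of that equality is already an equation in
        -- `A`.
        ; surjective = λ x → let i , x∈Bᵢ = covers x in
            (i , x , x∈Bᵢ) , λ (_ , _ , _ , z≈x) → z≈x
        }
      ; *ₗ-homo        = λ _ _ → R.refl
      -- Being of degree `n` in the limit only provides some equal representative `y` of degree `n`,
      -- so the degree is carried back along the equality.
      ; Deg-preserving = λ { {n} (_ , _ , y∈Aₙ , _ , _ , _ , x≈y) →
          IsSubspace.resp (A.Deg-isSubspace n) (R.sym x≈y) y∈Aₙ }
      ; Deg-reflecting = λ { {x = i , x} x∈Aₙ →
          i , x , x∈Aₙ , i , (λ z∈ → z∈) , (λ z∈ → z∈) , R.refl }
      }

proposition3p4 : ∀ {ℓ : Level} (k : HeytingField ℓ ℓ ℓ) (A : GradedAlgebra k) →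
    Connected A →
    GeneratedInDegreeOne A →
    (B : FiniteDimensionalSubspace₁ A → Subalgebra A) →
    (∀ W → Quadratic (toGradedAlgebra (B W))) →
    (∀ W → FiniteDimensionalSubspace₁.Member W
             ⊆ Subalgebra.Member (B W) ∩ GradedAlgebra.Deg A 1) →
    (∀ W → FiniteDimensional (GradedAlgebra.leftModule (toGradedAlgebra (B W)))
             (GradedAlgebra.Deg (toGradedAlgebra (B W)) 1)) →
    (∀ W → UniversallyKoszul (toGradedAlgebra (B W))) →
    Filtered B →
    AsymptoticallyUniversallyKoszul A
proposition3p4 k A connected generated B quadratic W⊆B dim₁<∞ UK filtered = record
  { connected            = connected
  ; generatedInDegreeOne = generated
  -- Indexing by the subspaces themselves makes each `W` its own witness for `exhaustion`; distinct
  -- indices may give the same subalgebra, which `Filtered` allows.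
  ; Index                = FiniteDimensionalSubspace₁ A
  ; system               = B
  ; filtered             = filtered
  ; system-quadratic     = quadratic
  ; system-generated     = λ W → Quadratic.generatedInDegreeOne (quadratic W)
  ; system-dim₁<∞        = dim₁<∞
  ; system-UK            = UK
  ; limit-isomorphism    = naturalMap-isIsomorphism B filtered
      (λ x → generated-by-union B filtered
        (λ {x} x∈A₁ → line₁ x∈A₁ , proj₁ (W⊆B (line₁ x∈A₁) (∈Line A.leftModule x)))
        (generated x))
  ; exhaustion           = λ W → W , W⊆B W
  }
  where module A = GradedAlgebra A
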